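{- Let $i\in\{0,1\}$ and let $A$ be an $i$-diagonal incidence matrix of a symmetric $(v,k,\lambda)$ design. Then the array $B$ with entries in $\{0,1\}$ defined by $$B(x,y,z)=A(x,y)+A(y,z)+A(x,z)\ \bmod 2,\qquad x,y,z\in\{1,\dots,v\},$$ is a $\mathcal{C}^3_3(v,K_i,\Lambda_i)$-cube, where $$K_0=k(3v+4\lambda-6k),\qquad \Lambda_0=k(v-4\lambda-2)+2\lambda(2\lambda+1),$$ $$K_1=k(3v+4\lambda-2k)-4v\lambda,\qquad \Lambda_1=k(v-4\lambda+2)+2\lambda(2\lambda-1).$$
   Context: An incidence matrix of a symmetric $(v,k,\lambda)$ design is a $v\times v$ matrix over $\{0,1\}$ with exactly $k$ ones in every row and column, such that the scalar product of any two distinct rows, and of any two distinct columns, is $\lambda$. A matrix is $i$-diagonal if all its diagonal entries are equal to $i$. A $v\times v\times v$ array is a function on $\{1,\dots,v\}^3$. A layer is obtained by fixing one of the three coordinates; two layers are parallel if they fix the same coordinate, to different values; their scalar product is the sum over all positions of the product of corresponding entries. A $\mathcal{C}^3_3(v,K,\Lambda)$-cube is a $v\times v\times v$ array over $\{0,1\}$ such that every layer (in each of the three directions) contains exactly $K$ ones and every two parallel layers have scalar product $\Lambda$. -}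

module Defs where

open import Data.Fin.Base using (Fin; toℕ)
open import Data.Fin.Patterns using (0F; 1F; 2F)
open import Data.Fin.Properties using (_≟_)
open import Data.Integer.Base using (ℤ; +_; _+_; _-_; _*_)
open import Data.List.Base using (List; allFin; cartesianProduct; filter; length; map)
open import Data.Nat.Base as ℕ using (ℕ)
open import Data.Nat.DivMod using (_mod_)
open import Data.Nat.ListAction using (sum)
open import Data.Product.Base using (_×_; _,_)
open import Relation.Binary.PropositionalEquality.Core using (_≡_; _≢_)

-- The first argument of ones and dot lists the positions, each once.

ones : {P : Set} → List P → (P → Fin 2) → ℕ
ones ps f = length (filter (λ p → f p ≟ 1F) ps)

dot : {P : Set} → List P → (P → Fin 2) → (P → Fin 2) → ℕ
dot ps f g = sum (map (λ p → toℕ (f p) ℕ.* toℕ (g p)) ps)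

Matrix : ℕ → Set
Matrix v = Fin v → Fin v → Fin 2

record IsIncidenceMatrix (v k ℓ : ℕ) (A : Matrix v) : Set where
  field
    row-ones : ∀ x → ones (allFin v) (λ y → A x y) ≡ k
    col-ones : ∀ y → ones (allFin v) (λ x → A x y) ≡ k
    row-dot  : ∀ x x′ → x ≢ x′ → dot (allFin v) (λ y → A x y) (λ y → A x′ y) ≡ ℓ
    col-dot  : ∀ y y′ → y ≢ y′ → dot (allFin v) (λ x → A x y) (λ x → A x y′) ≡ ℓ

IsDiagonal : {v : ℕ} → Fin 2 → Matrix v → Set
IsDiagonal i A = ∀ x → A x x ≡ i

Array : ℕ → Set
Array v = Fin v → Fin v → Fin v → Fin 2

-- layer B d c fixes coordinate d (counted from 0) to the value c.

layer : {v : ℕ} → Array v → Fin 3 → Fin v → (Fin v × Fin v → Fin 2)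
layer B 0F c (y , z) = B c y z
layer B 1F c (x , z) = B x c z
layer B 2F c (x , y) = B x y c

positions : (v : ℕ) → List (Fin v × Fin v)
positions v = cartesianProduct (allFin v) (allFin v)

-- K and Λ are integers so that they can be given by formulas with
-- genuine (not truncated) subtraction.

record IsCube (v : ℕ) (K Λ : ℤ) (B : Array v) : Set where
  field
    layer-ones : ∀ d c → + ones (positions v) (layer B d c) ≡ K
    layer-dot  : ∀ d c c′ → c ≢ c′ →
                 + dot (positions v) (layer B d c) (layer B d c′) ≡ Λ

cubeOf : {v : ℕ} → Matrix v → Array v
cubeOf A x y z = (toℕ (A x y) ℕ.+ toℕ (A y z) ℕ.+ toℕ (A x z)) mod 2

K : Fin 2 → (v k ℓ : ℤ) → ℤ
K 0F v k ℓ = k * (+ 3 * v + + 4 * ℓ - + 6 * k)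
K 1F v k ℓ = k * (+ 3 * v + + 4 * ℓ - + 2 * k) - + 4 * v * ℓ

Λ : Fin 2 → (v k ℓ : ℤ) → ℤ
Λ 0F v k ℓ = k * (v - + 4 * ℓ - + 2) + + 2 * ℓ * (+ 2 * ℓ + + 1)
Λ 1F v k ℓ = k * (v - + 4 * ℓ + + 2) + + 2 * ℓ * (+ 2 * ℓ - + 1)

{-# OPTIONS --safe #-}

-- Passing from 0/1 to signs by b ↦ (-1)^b turns addition mod 2 into
-- multiplication, so with σ = 1 - 2A the array B becomes σ(x,y) σ(y,z) σ(x,z).
-- The rows of σ have constant sum s, and distinct rows have constant scalar
-- product m; the same holds for columns. Summing a layer over one
-- coordinate produces such scalar products, all equal to m except one equal to
-- v, so the layer has sum m s + (v - m) σ(c,c). In the product of two parallel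
-- layers one of the three factors squares to 1 and the rest splits as m · m.

module Submission where

open import Data.Fin.Base using (Fin; punchIn; suc; toℕ)
open import Data.Fin.Patterns using (0F; 1F; 2F)
open import Data.Fin.Properties using (punchInᵢ≢i)
open import Data.Integer.Base using (ℤ; +_; -_; _+_; _-_; _*_; 0ℤ; 1ℤ)
open import Data.Integer.Properties
  using (+-*-semiring; +-assoc; +-identityˡ; +-identityʳ; *-assoc; *-identityˡ; *-identityʳ;
         *-cancelˡ-≡; i≡j⇒i-j≡0)
open import Data.Integer.Tactic.RingSolver using (solve-∀)
open import Data.List.Base
  using (List; []; _∷_; _++_; allFin; cartesianProduct; foldr; map; tabulate)
open import Data.Nat.Base as ℕ using (ℕ)
open import Data.Nat.DivMod using (_mod_)
open import Data.Product.Base using (_×_; _,_)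
open import Defs
open import Function.Base using (_∘_)
open import Relation.Binary.PropositionalEquality
  using (_≡_; _≢_; refl; sym; trans; cong; cong₂; module ≡-Reasoning)
open import Algebra.Properties.Semiring.Sum +-*-semiring
  using (sum-syntax; sum-cong-≗; sum-remove; ∑-comm; *-distribˡ-sum; *-distribʳ-sum)
open ≡-Reasoning

-- Signs of bits

sgn : Fin 2 → ℤ
sgn 0F = 1ℤ
sgn 1F = - 1ℤ

sgn-mod : ∀ a b c → sgn ((toℕ a ℕ.+ toℕ b ℕ.+ toℕ c) mod 2) ≡ sgn a * sgn b * sgn c
sgn-mod 0F 0F 0F = refl
sgn-mod 0F 0F 1F = refl
sgn-mod 0F 1F 0F = refl
sgn-mod 0F 1F 1F = refl
sgn-mod 1F 0F 0F = refl
sgn-mod 1F 0F 1F = refl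
sgn-mod 1F 1F 0F = refl
sgn-mod 1F 1F 1F = refl

sgn-square : ∀ a → sgn a * sgn a ≡ 1ℤ
sgn-square 0F = refl
sgn-square 1F = refl

sgn-square-* : ∀ a b → sgn a * sgn a * b ≡ b
sgn-square-* a b = trans (cong (_* b) (sgn-square a)) (*-identityˡ b)

-- Sign sums over lists of positions

∑ₗ : {P : Set} → List P → (P → ℤ) → ℤ
∑ₗ ps f = foldr (λ p s → f p + s) 0ℤ ps

-- Sum of `sgn b = 1 - 2b`. The number of positions is kept as a sum of ones, so that the
-- conversions to sums over `Fin v` evaluate it too.
∑ₗ-sgn : {P : Set} (ps : List P) (f : P → Fin 2) →
  ∑ₗ ps (sgn ∘ f) ≡ ∑ₗ ps (λ _ → 1ℤ) - + 2 * + ones ps f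
∑ₗ-sgn [] f = refl
∑ₗ-sgn (p ∷ ps) f with f p | ∑ₗ-sgn ps f
... | 0F | ih = trans (cong (_+_ 1ℤ) ih) (step (∑ₗ ps (λ _ → 1ℤ)) (+ ones ps f))
  where
  step : ∀ n a → 1ℤ + (n - + 2 * a) ≡ 1ℤ + n - + 2 * a
  step = solve-∀
... | 1F | ih = trans (cong (_+_ (- 1ℤ)) ih) (step (∑ₗ ps (λ _ → 1ℤ)) (+ ones ps f))
  where
  step : ∀ n a → - 1ℤ + (n - + 2 * a) ≡ 1ℤ + n - + 2 * (1ℤ + a)
  step = solve-∀

-- Termwise this is `(1 - 2a)(1 - 2b) = 1 - 2a - 2b + 4ab`.
∑ₗ-sgn-* : {P : Set} (ps : List P) (f g : P → Fin 2) →
  ∑ₗ ps (λ p → sgn (f p) * sgn (g p)) ≡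
  ∑ₗ ps (λ _ → 1ℤ) - + 2 * + ones ps f - + 2 * + ones ps g + + 4 * + dot ps f g
∑ₗ-sgn-* [] f g = refl
∑ₗ-sgn-* (p ∷ ps) f g with f p | g p | ∑ₗ-sgn-* ps f g
... | 0F | 0F | ih = trans (cong (_+_ 1ℤ) ih)
  (step (∑ₗ ps (λ _ → 1ℤ)) (+ ones ps f) (+ ones ps g) (+ dot ps f g))
  where
  step : ∀ n a b d → 1ℤ + (n - + 2 * a - + 2 * b + + 4 * d) ≡
                     1ℤ + n - + 2 * a - + 2 * b + + 4 * d
  step = solve-∀
... | 0F | 1F | ih = trans (cong (_+_ (- 1ℤ)) ih)
  (step (∑ₗ ps (λ _ → 1ℤ)) (+ ones ps f) (+ ones ps g) (+ dot ps f g))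
  where
  step : ∀ n a b d → - 1ℤ + (n - + 2 * a - + 2 * b + + 4 * d) ≡
                     1ℤ + n - + 2 * a - + 2 * (1ℤ + b) + + 4 * d
  step = solve-∀
... | 1F | 0F | ih = trans (cong (_+_ (- 1ℤ)) ih)
  (step (∑ₗ ps (λ _ → 1ℤ)) (+ ones ps f) (+ ones ps g) (+ dot ps f g))
  where
  step : ∀ n a b d → - 1ℤ + (n - + 2 * a - + 2 * b + + 4 * d) ≡
                     1ℤ + n - + 2 * (1ℤ + a) - + 2 * b + + 4 * d
  step = solve-∀
... | 1F | 1F | ih = trans (cong (_+_ 1ℤ) ih)
  (step (∑ₗ ps (λ _ → 1ℤ)) (+ ones ps f) (+ ones ps g) (+ dot ps f g))
  where
  step : ∀ n a b d → 1ℤ + (n - + 2 * a - + 2 * b + + 4 * d) ≡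
                     1ℤ + n - + 2 * (1ℤ + a) - + 2 * (1ℤ + b) + + 4 * (1ℤ + d)
  step = solve-∀

∑ₗ-++ : {P : Set} (ps qs : List P) (f : P → ℤ) → ∑ₗ (ps ++ qs) f ≡ ∑ₗ ps f + ∑ₗ qs f
∑ₗ-++ []       qs f = sym (+-identityˡ _)
∑ₗ-++ (p ∷ ps) qs f = trans (cong (_+_ (f p)) (∑ₗ-++ ps qs f)) (sym (+-assoc (f p) _ _))

∑ₗ-map : {P Q : Set} (h : P → Q) (ps : List P) (f : Q → ℤ) → ∑ₗ (map h ps) f ≡ ∑ₗ ps (f ∘ h)
∑ₗ-map h []       f = refl
∑ₗ-map h (p ∷ ps) f = cong (_+_ (f (h p))) (∑ₗ-map h ps f)

∑ₗ-tabulate : {P : Set} {n : ℕ} (h : Fin n → P) (f : P → ℤ) →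
  ∑ₗ (tabulate h) f ≡ ∑[ i < n ] f (h i)
∑ₗ-tabulate {n = ℕ.zero}  h f = refl
∑ₗ-tabulate {n = ℕ.suc n} h f = cong (_+_ (f (h 0F))) (∑ₗ-tabulate (h ∘ suc) f)

∑ₗ-cartesianProduct : {P Q : Set} (ps : List P) (qs : List Q) (f : P × Q → ℤ) →
  ∑ₗ (cartesianProduct ps qs) f ≡ ∑ₗ ps (λ p → ∑ₗ qs (λ q → f (p , q)))
∑ₗ-cartesianProduct []       qs f = refl
∑ₗ-cartesianProduct (p ∷ ps) qs f = trans (∑ₗ-++ (map (p ,_) qs) _ f)
  (cong₂ _+_ (∑ₗ-map (p ,_) qs f) (∑ₗ-cartesianProduct ps qs f))

-- Passage from the list sums that match `ones` and `dot` to sums indexed by `Fin v`, where the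
-- order of summation can be exchanged and a single term split off.
∑ₗ-positions : ∀ v (f : Fin v × Fin v → ℤ) →
  ∑ₗ (positions v) f ≡ ∑[ x < v ] ∑[ y < v ] f (x , y)
∑ₗ-positions v f = begin
  ∑ₗ (positions v) f
    ≡⟨ ∑ₗ-cartesianProduct (allFin v) (allFin v) f ⟩
  ∑ₗ (allFin v) (λ x → ∑ₗ (allFin v) (λ y → f (x , y)))
    ≡⟨ ∑ₗ-tabulate {n = v} (λ x → x) _ ⟩
  ∑[ x < v ] ∑ₗ (allFin v) (λ y → f (x , y))
    ≡⟨ sum-cong-≗ (λ x → ∑ₗ-tabulate (λ y → y) (λ y → f (x , y))) ⟩
  ∑[ x < v ] ∑[ y < v ] f (x , y) ∎

-- Finite sums over `Fin n`

∑-const : ∀ n a → ∑[ i < n ] a ≡ + n * a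
∑-const ℕ.zero    a = refl
∑-const (ℕ.suc n) a = trans (cong (_+_ a) (∑-const n a)) (step a (+ n))
  where
  step : ∀ a n → a + n * a ≡ (1ℤ + n) * a
  step = solve-∀

∑-*ˡ : ∀ {n} a (f : Fin n → ℤ) → ∑[ i < n ] (a * f i) ≡ a * ∑[ i < n ] f i
∑-*ˡ a f = sym (*-distribˡ-sum a f)

∑-*ʳ : ∀ {n} a (f : Fin n → ℤ) → ∑[ i < n ] (f i * a) ≡ (∑[ i < n ] f i) * a
∑-*ʳ a f = sym (*-distribʳ-sum a f)

∑-∑-* : ∀ {m n} (f : Fin m → ℤ) (g : Fin n → ℤ) →
  ∑[ i < m ] ∑[ j < n ] (f i * g j) ≡ (∑[ i < m ] f i) * ∑[ j < n ] g j
∑-∑-* {n = n} f g = trans (sum-cong-≗ (λ i → ∑-*ˡ (f i) g)) (∑-*ʳ (∑[ j < n ] g j) f)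

-- The function `e` is the constant `m` plus a correction `p - m` concentrated at `c`. This is the
-- shape of the scalar products of one row with all rows: `v` with itself, a common value with every
-- other.
∑-*-peak : ∀ {n} (f e : Fin n → ℤ) (c : Fin n) {p m : ℤ} →
  e c ≡ p → (∀ i → i ≢ c → e i ≡ m) →
  ∑[ i < n ] (f i * e i) ≡ m * (∑[ i < n ] f i) + (p - m) * f c
∑-*-peak {ℕ.suc n} f e c {p} {m} ec≡p e≡m = begin
  ∑[ i < ℕ.suc n ] (f i * e i)
    ≡⟨ sum-remove {i = c} (λ i → f i * e i) ⟩
  f c * e c + ∑[ j < n ] (f (punch j) * e (punch j))
    ≡⟨ cong₂ _+_ (cong (f c *_) ec≡p)
         (trans (sum-cong-≗ (λ j → cong (f (punch j) *_) (e≡m _ (punchInᵢ≢i c j))))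
                (∑-*ʳ m (f ∘ punch))) ⟩
  f c * p + (∑[ j < n ] f (punch j)) * m
    ≡⟨ step (f c) p m _ ⟩
  m * (f c + ∑[ j < n ] f (punch j)) + (p - m) * f c
    ≡⟨ cong (λ s → m * s + (p - m) * f c) (sum-remove {i = c} f) ⟨
  m * (∑[ i < ℕ.suc n ] f i) + (p - m) * f c ∎
  where
  punch = punchIn c
  step : ∀ a p m s → a * p + s * m ≡ m * (a + s) + (p - m) * a
  step = solve-∀

∑-factorˡ : ∀ {n} a (f : Fin n → ℤ) {h : Fin n → ℤ} →
  (∀ i → h i ≡ a * f i) → ∑[ i < n ] h i ≡ a * ∑[ i < n ] f i
∑-factorˡ a f h≡ = trans (sum-cong-≗ h≡) (∑-*ˡ a f)

-- Row and column products of the sign matrix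

module Signs {v k ℓ : ℕ} {A : Matrix v} (inc : IsIncidenceMatrix v k ℓ A) where
  open IsIncidenceMatrix inc

  σ : Fin v → Fin v → ℤ
  σ x y = sgn (A x y)

  -- In `m` the term `+ 2 * + k` stands twice, once for each of the two rows, so that `m` agrees
  -- literally with the right-hand side of `∑ₗ-sgn-*`.
  s m : ℤ
  s = + v - + 2 * + k
  m = + v - + 2 * + k - + 2 * + k + + 4 * + ℓ

  layerSum : Fin v → ℤ
  layerSum c = m * s + (+ v - m) * σ c c

  ∑-1 : ∑[ x < v ] 1ℤ ≡ + v
  ∑-1 = trans (∑-const v 1ℤ) (*-identityʳ (+ v))

  ∑ₗ-1 : ∑ₗ (allFin v) (λ _ → 1ℤ) ≡ + v
  ∑ₗ-1 = trans (∑ₗ-tabulate {n = v} (λ x → x) (λ _ → 1ℤ)) ∑-1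

  ∑ₗ-positions-1 : ∑ₗ (positions v) (λ _ → 1ℤ) ≡ + v * + v
  ∑ₗ-positions-1 = begin
    ∑ₗ (positions v) (λ _ → 1ℤ)  ≡⟨ ∑ₗ-positions v (λ _ → 1ℤ) ⟩
    ∑[ x < v ] ∑[ y < v ] 1ℤ     ≡⟨ sum-cong-≗ (λ (_ : Fin v) → ∑-1) ⟩
    ∑[ x < v ] (+ v)             ≡⟨ ∑-const v (+ v) ⟩
    + v * + v                    ∎

  ∑-sgn : (f : Fin v → Fin 2) → ones (allFin v) f ≡ k → ∑[ x < v ] sgn (f x) ≡ s
  ∑-sgn f refl = trans (sym (∑ₗ-tabulate (λ x → x) (sgn ∘ f)))
    (trans (∑ₗ-sgn (allFin v) f) (cong (_- + 2 * + k) ∑ₗ-1))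

  ∑-sgn-* : (f g : Fin v → Fin 2) → ones (allFin v) f ≡ k → ones (allFin v) g ≡ k →
    dot (allFin v) f g ≡ ℓ → ∑[ x < v ] (sgn (f x) * sgn (g x)) ≡ m
  ∑-sgn-* f g fk gk refl = begin
    ∑[ x < v ] (sgn (f x) * sgn (g x))
      ≡⟨ ∑ₗ-tabulate (λ x → x) (λ x → sgn (f x) * sgn (g x)) ⟨
    ∑ₗ (allFin v) (λ x → sgn (f x) * sgn (g x))
      ≡⟨ ∑ₗ-sgn-* (allFin v) f g ⟩
    ∑ₗ (allFin v) (λ _ → 1ℤ) - + 2 * + ones (allFin v) f - + 2 * + ones (allFin v) g + + 4 * + ℓ
      ≡⟨ cong (_+ + 4 * + ℓ) (cong₂ _-_ (cong₂ _-_ ∑ₗ-1 (cong (λ n → + 2 * + n) fk))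
           (cong (λ n → + 2 * + n) gk)) ⟩
    m ∎

  ∑-sgn-square : (f : Fin v → Fin 2) → ∑[ x < v ] (sgn (f x) * sgn (f x)) ≡ + v
  ∑-sgn-square f = trans (sum-cong-≗ (sgn-square ∘ f)) ∑-1

  row-sum : ∀ x → ∑[ y < v ] σ x y ≡ s
  row-sum x = ∑-sgn (A x) (row-ones x)

  col-sum : ∀ y → ∑[ x < v ] σ x y ≡ s
  col-sum y = ∑-sgn (λ x → A x y) (col-ones y)

  row-gram : ∀ x x′ → x ≢ x′ → ∑[ y < v ] (σ x y * σ x′ y) ≡ m
  row-gram x x′ x≢x′ = ∑-sgn-* (A x) (A x′) (row-ones x) (row-ones x′) (row-dot x x′ x≢x′)

  col-gram : ∀ y y′ → y ≢ y′ → ∑[ x < v ] (σ x y * σ x y′) ≡ m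
  col-gram y y′ y≢y′ =
    ∑-sgn-* (λ x → A x y) (λ x → A x y′) (col-ones y) (col-ones y′) (col-dot y y′ y≢y′)

  -- In terms of v, k and ℓ this is k (k - 1) = ℓ (v - 1).
  s²-value : Fin v → s * s ≡ m * + v + (+ v - m)
  s²-value c = begin
    -- Double counting: row `c` of `σ` is summed against all rows. Summing over `x` first gives
    -- column sums, hence `s * s`; summing over `y` first gives scalar products of rows with their
    -- peak at `c`. The index `c` matters: for `v = 0` nothing ties `k` to `ℓ`.
    s * s
      ≡⟨ cong (_* s) (row-sum c) ⟨
    (∑[ y < v ] σ c y) * s
      ≡⟨ ∑-*ʳ s (σ c) ⟨
    ∑[ y < v ] (σ c y * s)
      ≡⟨ sum-cong-≗ (λ y → trans (cong (σ c y *_) (sym (col-sum y)))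
           (sym (∑-*ˡ (σ c y) (λ x → σ x y)))) ⟩
    ∑[ y < v ] ∑[ x < v ] (σ c y * σ x y)
      ≡⟨ ∑-comm (λ y x → σ c y * σ x y) ⟩
    ∑[ x < v ] ∑[ y < v ] (σ c y * σ x y)
      ≡⟨ sum-cong-≗ (λ x → sym (*-identityˡ (∑[ y < v ] (σ c y * σ x y)))) ⟩
    ∑[ x < v ] (1ℤ * ∑[ y < v ] (σ c y * σ x y))
      ≡⟨ ∑-*-peak (λ _ → 1ℤ) _ c (∑-sgn-square (A c)) (λ x x≢c → row-gram c x (x≢c ∘ sym)) ⟩
    m * ∑[ x < v ] 1ℤ + (+ v - m) * 1ℤ
      ≡⟨ cong₂ _+_ (cong (m *_) ∑-1) (*-identityʳ _) ⟩
    m * + v + (+ v - m) ∎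

  -- Sums of layers

  row-layer : ∀ c → ∑[ y < v ] (σ c y * ∑[ z < v ] (σ y z * σ c z)) ≡ layerSum c
  row-layer c = trans
    (∑-*-peak (σ c) _ c (∑-sgn-square (A c)) (λ y y≢c → row-gram y c y≢c))
    (cong (λ t → m * t + (+ v - m) * σ c c) (row-sum c))

  col-layer-by-rows : ∀ c → ∑[ x < v ] (σ x c * ∑[ z < v ] (σ x z * σ c z)) ≡ layerSum c
  col-layer-by-rows c = trans
    (∑-*-peak (λ x → σ x c) _ c (∑-sgn-square (A c)) (λ x x≢c → row-gram x c x≢c))
    (cong (λ t → m * t + (+ v - m) * σ c c) (col-sum c))

  col-layer : ∀ c → ∑[ y < v ] (σ y c * ∑[ x < v ] (σ x y * σ x c)) ≡ layerSum c
  col-layer c = trans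
    (∑-*-peak (λ y → σ y c) _ c (∑-sgn-square (λ x → A x c)) (λ y y≢c → col-gram y c y≢c))
    (cong (λ t → m * t + (+ v - m) * σ c c) (col-sum c))

  B : Array v
  B = cubeOf A

  σ₃ : Fin v → Fin v → Fin v → ℤ
  σ₃ x y z = σ x y * σ y z * σ x z

  sgn-B : ∀ x y z → sgn (B x y z) ≡ σ₃ x y z
  sgn-B x y z = sgn-mod (A x y) (A y z) (A x z)

  -- The inner summation always runs over a coordinate that pairs two lines of `σ`, one of them of
  -- index `c`: over `z` it pairs rows when `x` or `y` is fixed, over `x` it pairs columns when `z`
  -- is fixed. The remaining factor, a row or column of index `c`, weights the outer sum.
  ∑-layer : ∀ d c → ∑[ p < v ] ∑[ q < v ] sgn (layer B d c (p , q)) ≡ layerSum c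
  ∑-layer 0F c = trans
    (sum-cong-≗ λ y → ∑-factorˡ (σ c y) (λ z → σ y z * σ c z)
      (λ z → trans (sgn-B c y z) (*-assoc (σ c y) _ _)))
    (row-layer c)
  ∑-layer 1F c = trans
    (sum-cong-≗ λ x → ∑-factorˡ (σ x c) (λ z → σ x z * σ c z)
      (λ z → trans (sgn-B x c z) (step (σ x c) _ _)))
    (col-layer-by-rows c)
    where
    step : ∀ a b d → a * b * d ≡ a * (d * b)
    step = solve-∀
  -- A layer fixing `z` is indexed by `(x , y)`, so the sums are exchanged to make `x` the inner
  -- variable.
  ∑-layer 2F c = trans (∑-comm (λ x y → sgn (B x y c))) (trans
    (sum-cong-≗ λ y → ∑-factorˡ (σ y c) (λ x → σ x y * σ x c)
      (λ x → trans (sgn-B x y c) (step (σ x y) _ _)))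
    (col-layer c))
    where
    step : ∀ a b d → a * b * d ≡ b * (a * d)
    step = solve-∀

  -- Products of parallel layers

  ∑-∑-split : (f g : Fin v → ℤ) {h : Fin v → Fin v → ℤ} →
    ∑[ p < v ] f p ≡ m → ∑[ q < v ] g q ≡ m → (∀ p q → h p q ≡ f p * g q) → ∑[ p < v ] ∑[ q < v ] h p q ≡ m * m
  ∑-∑-split f g f≡ g≡ h≡ = trans (sum-cong-≗ (λ p → sum-cong-≗ (h≡ p)))
    (trans (∑-∑-* f g) (cong₂ _*_ f≡ g≡))

  -- The factor without the fixed coordinate is common to both layers and squares to 1. The others
  -- group by free coordinate into two scalar products of lines `c` and `c′`: two of rows, one of
  -- each kind, or two of columns, for `d` equal to 0, 1, 2.
  ∑-layer-* : ∀ d c c′ → c ≢ c′ →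
    ∑[ p < v ] ∑[ q < v ] (sgn (layer B d c (p , q)) * sgn (layer B d c′ (p , q))) ≡ m * m
  ∑-layer-* 0F c c′ c≢c′ = ∑-∑-split (λ y → σ c y * σ c′ y) (λ z → σ c z * σ c′ z)
    (row-gram c c′ c≢c′) (row-gram c c′ c≢c′) λ y z → begin
      sgn (B c y z) * sgn (B c′ y z)
        ≡⟨ cong₂ _*_ (sgn-B c y z) (sgn-B c′ y z) ⟩
      σ₃ c y z * σ₃ c′ y z
        ≡⟨ step (σ c y) (σ y z) (σ c z) (σ c′ y) (σ c′ z) ⟩
      (σ y z * σ y z) * ((σ c y * σ c′ y) * (σ c z * σ c′ z))
        ≡⟨ sgn-square-* (A y z) _ ⟩
      (σ c y * σ c′ y) * (σ c z * σ c′ z) ∎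
    where
    step : ∀ a e b a′ b′ → (a * e * b) * (a′ * e * b′) ≡ (e * e) * ((a * a′) * (b * b′))
    step = solve-∀
  ∑-layer-* 1F c c′ c≢c′ = ∑-∑-split (λ x → σ x c * σ x c′) (λ z → σ c z * σ c′ z)
    (col-gram c c′ c≢c′) (row-gram c c′ c≢c′) λ x z → begin
      sgn (B x c z) * sgn (B x c′ z)
        ≡⟨ cong₂ _*_ (sgn-B x c z) (sgn-B x c′ z) ⟩
      σ₃ x c z * σ₃ x c′ z
        ≡⟨ step (σ x c) (σ c z) (σ x z) (σ x c′) (σ c′ z) ⟩
      (σ x z * σ x z) * ((σ x c * σ x c′) * (σ c z * σ c′ z))
        ≡⟨ sgn-square-* (A x z) _ ⟩
      (σ x c * σ x c′) * (σ c z * σ c′ z) ∎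
    where
    step : ∀ a b e a′ b′ → (a * b * e) * (a′ * b′ * e) ≡ (e * e) * ((a * a′) * (b * b′))
    step = solve-∀
  ∑-layer-* 2F c c′ c≢c′ = ∑-∑-split (λ x → σ x c * σ x c′) (λ y → σ y c * σ y c′)
    (col-gram c c′ c≢c′) (col-gram c c′ c≢c′) λ x y → begin
      sgn (B x y c) * sgn (B x y c′)
        ≡⟨ cong₂ _*_ (sgn-B x y c) (sgn-B x y c′) ⟩
      σ₃ x y c * σ₃ x y c′
        ≡⟨ step (σ x y) (σ y c) (σ x c) (σ y c′) (σ x c′) ⟩
      (σ x y * σ x y) * ((σ x c * σ x c′) * (σ y c * σ y c′))
        ≡⟨ sgn-square-* (A x y) _ ⟩
      (σ x c * σ x c′) * (σ y c * σ y c′) ∎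
    where
    step : ∀ e b a b′ a′ → (e * b * a) * (e * b′ * a′) ≡ (e * e) * ((a * a′) * (b * b′))
    step = solve-∀

  -- From sign sums back to counts

  2*ones-layer : ∀ d c → + 2 * + ones (positions v) (layer B d c) ≡ + v * + v - layerSum c
  2*ones-layer d c = begin
    + 2 * o
      ≡⟨ step (+ v * + v) o ⟩
    + v * + v - (+ v * + v - + 2 * o)
      ≡⟨ cong (λ n → + v * + v - (n - + 2 * o)) ∑ₗ-positions-1 ⟨
    + v * + v - (∑ₗ (positions v) (λ _ → 1ℤ) - + 2 * o)
      ≡⟨ cong (_-_ (+ v * + v)) (∑ₗ-sgn (positions v) f) ⟨
    + v * + v - ∑ₗ (positions v) (sgn ∘ f)
      ≡⟨ cong (_-_ (+ v * + v)) (trans (∑ₗ-positions v (sgn ∘ f)) (∑-layer d c)) ⟩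
    + v * + v - layerSum c ∎
    where
    f : Fin v × Fin v → Fin 2
    f = layer B d c
    o : ℤ
    o = + ones (positions v) f
    step : ∀ n o → + 2 * o ≡ n - (n - + 2 * o)
    step = solve-∀

  -- This is `∑ₗ-sgn-*` solved for `dot`, with both counts of ones taken from `2*ones-layer`. The
  -- factor 4 stays in front to avoid division in `ℤ`.
  4*dot-layer : ∀ d c c′ → c ≢ c′ →
    + 4 * + dot (positions v) (layer B d c) (layer B d c′) ≡
    m * m + (+ v * + v - layerSum c) + (+ v * + v - layerSum c′) - + v * + v
  4*dot-layer d c c′ c≢c′ = begin
    + 4 * D
      ≡⟨ step (+ v * + v) (+ 2 * o) (+ 2 * o′) (+ 4 * D) ⟩
    (+ v * + v - + 2 * o - + 2 * o′ + + 4 * D) + + 2 * o + + 2 * o′ - + v * + v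
      ≡⟨ cong (_- + v * + v) (cong₂ _+_ (cong₂ _+_ gram (2*ones-layer d c)) (2*ones-layer d c′)) ⟩
    m * m + (+ v * + v - layerSum c) + (+ v * + v - layerSum c′) - + v * + v ∎
    where
    f f′ : Fin v × Fin v → Fin 2
    f  = layer B d c
    f′ = layer B d c′
    o o′ D : ℤ
    o  = + ones (positions v) f
    o′ = + ones (positions v) f′
    D  = + dot (positions v) f f′
    step : ∀ n a b e → e ≡ (n - a - b + e) + a + b - n
    step = solve-∀
    gram : + v * + v - + 2 * o - + 2 * o′ + + 4 * D ≡ m * m
    gram = begin
      + v * + v - + 2 * o - + 2 * o′ + + 4 * D
        ≡⟨ cong (λ n → n - + 2 * o - + 2 * o′ + + 4 * D) ∑ₗ-positions-1 ⟨
      ∑ₗ (positions v) (λ _ → 1ℤ) - + 2 * o - + 2 * o′ + + 4 * D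
        ≡⟨ ∑ₗ-sgn-* (positions v) f f′ ⟨
      ∑ₗ (positions v) (λ p → sgn (f p) * sgn (f′ p))
        ≡⟨ ∑ₗ-positions v (λ p → sgn (f p) * sgn (f′ p)) ⟩
      ∑[ p < v ] ∑[ q < v ] (sgn (f (p , q)) * sgn (f′ (p , q)))
        ≡⟨ ∑-layer-* d c c′ c≢c′ ⟩
      m * m ∎

  -- Here the diagonal hypothesis enters: it makes the layer sum independent of `c`.
  layerSum-diagonal : ∀ {i} → IsDiagonal i A → ∀ c → layerSum c ≡ m * s + (+ v - m) * sgn i
  layerSum-diagonal diag c = cong (λ a → m * s + (+ v - m) * sgn a) (diag c)

-- Polynomial identities for the parameters

-- Without the hypothesis the sides differ by ± 4 (k (k - 1) - ℓ (v - 1)), with sign + for i = 0.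
2*K : ∀ i v k ℓ →
  let s = v - + 2 * k
      m = v - + 2 * k - + 2 * k + + 4 * ℓ
  in s * s ≡ m * v + (v - m) → v * v - (m * s + (v - m) * sgn i) ≡ + 2 * K i v k ℓ
2*K 0F v k ℓ eq = trans (expand v k ℓ)
  (trans (cong (_+_ (+ 2 * K 0F v k ℓ)) (i≡j⇒i-j≡0 eq)) (+-identityʳ _))
  where
  expand : ∀ v k ℓ →
    let s = v - + 2 * k
        m = v - + 2 * k - + 2 * k + + 4 * ℓ
    in v * v - (m * s + (v - m) * 1ℤ) ≡
       + 2 * (k * (+ 3 * v + + 4 * ℓ - + 6 * k)) + (s * s - (m * v + (v - m)))
  expand = solve-∀
2*K 1F v k ℓ eq = trans (expand v k ℓ)
  (trans (cong (_+_ (+ 2 * K 1F v k ℓ)) (i≡j⇒i-j≡0 (sym eq))) (+-identityʳ _))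
  where
  expand : ∀ v k ℓ →
    let s = v - + 2 * k
        m = v - + 2 * k - + 2 * k + + 4 * ℓ
    in v * v - (m * s + (v - m) * - 1ℤ) ≡
       + 2 * (k * (+ 3 * v + + 4 * ℓ - + 2 * k) - + 4 * v * ℓ) + ((m * v + (v - m)) - s * s)
  expand = solve-∀

-- Since `v - m = 4(k - ℓ)`, the left side is `4(kv - 4kℓ + 4ℓ²) - 8(k - ℓ) sgn i`, so the two cases
-- differ only in the sign of the last term. Splitting on `i` lets `sgn i` and `Λ i` reduce to
-- polynomials for the ring solver.
4*Λ : ∀ i v k ℓ →
  let s = v - + 2 * k
      m = v - + 2 * k - + 2 * k + + 4 * ℓ
      L = m * s + (v - m) * sgn i
  in m * m + (v * v - L) + (v * v - L) - v * v ≡ + 4 * Λ i v k ℓ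
4*Λ 0F = expand
  where
  expand : ∀ v k ℓ →
    let s = v - + 2 * k
        m = v - + 2 * k - + 2 * k + + 4 * ℓ
        L = m * s + (v - m) * 1ℤ
    in m * m + (v * v - L) + (v * v - L) - v * v ≡
       + 4 * (k * (v - + 4 * ℓ - + 2) + + 2 * ℓ * (+ 2 * ℓ + + 1))
  expand = solve-∀
4*Λ 1F = expand
  where
  expand : ∀ v k ℓ →
    let s = v - + 2 * k
        m = v - + 2 * k - + 2 * k + + 4 * ℓ
        L = m * s + (v - m) * - 1ℤ
    in m * m + (v * v - L) + (v * v - L) - v * v ≡
       + 4 * (k * (v - + 4 * ℓ + + 2) + + 2 * ℓ * (+ 2 * ℓ - + 1))
  expand = solve-∀

theorem4p6 : (v k ℓ : ℕ) (i : Fin 2) (A : Matrix v) →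
    IsIncidenceMatrix v k ℓ A → IsDiagonal i A →
    IsCube v (K i (+ v) (+ k) (+ ℓ)) (Λ i (+ v) (+ k) (+ ℓ)) (cubeOf A)
theorem4p6 v k ℓ i A inc diag = record
  { layer-ones = λ d c → *-cancelˡ-≡ (+ 2) _ _ (begin
      + 2 * + ones (positions v) (layer (cubeOf A) d c)
        ≡⟨ 2*ones-layer d c ⟩
      + v * + v - layerSum c
        ≡⟨ cong (_-_ (+ v * + v)) (layerSum-diagonal diag c) ⟩
      + v * + v - (m * s + (+ v - m) * sgn i)
        -- The fixed coordinate `c` of the layer also serves as the row needed in the double
        -- counting.
        ≡⟨ 2*K i (+ v) (+ k) (+ ℓ) (s²-value c) ⟩
      + 2 * K i (+ v) (+ k) (+ ℓ) ∎)
  ; layer-dot = λ d c c′ c≢c′ → *-cancelˡ-≡ (+ 4) _ _ (begin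
      + 4 * + dot (positions v) (layer (cubeOf A) d c) (layer (cubeOf A) d c′)
        ≡⟨ 4*dot-layer d c c′ c≢c′ ⟩
      m * m + (+ v * + v - layerSum c) + (+ v * + v - layerSum c′) - + v * + v
        ≡⟨ cong₂ (λ L L′ → m * m + (+ v * + v - L) + (+ v * + v - L′) - + v * + v)
             (layerSum-diagonal diag c) (layerSum-diagonal diag c′) ⟩
      _ ≡⟨ 4*Λ i (+ v) (+ k) (+ ℓ) ⟩
      + 4 * Λ i (+ v) (+ k) (+ ℓ) ∎)
  }
  where open Signs inc
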